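{- Let $\{\sigma_i\}_{i\in I}$ be a family of contiguous patterns. In (i), for each $i\in I$ let $k_i$ be an integer greater than all letters of $\sigma_i$; in (ii), assume that all letters of every $\sigma_i$ are greater than $1$. Let $n\ge 1$ and $\pi\in\mathcal{S}_n$. Write $\pi=\pi_{\ell}\,n\,\pi_r$, where $\pi_\ell$ and $\pi_r$ are the parts of $\pi$ to the left and to the right of the letter $n$, and $\pi=\widehat{\pi}_{\ell}\,1\,\widehat{\pi}_r$, where $\widehat{\pi}_\ell$ and $\widehat{\pi}_r$ are the parts of $\pi$ to the left and to the right of the letter $1$. Then: (i) $\pi$ avoids all the patterns $k_i$-$\sigma_i$-$k_i$ ($i\in I$) if and only if $\pi_\ell$ avoids all the patterns $k_i$-$\sigma_i$ ($i\in I$) and $\pi_r$ avoids all the patterns $\sigma_i$-$k_i$ ($i\in I$). (ii) $\pi$ avoids all the patterns $1$-$\sigma_i$-$1$ ($i\in I$) if and only if $\widehat{\pi}_\ell$ avoids all the patterns $1$-$\sigma_i$ ($i\in I$) and $\widehat{\pi}_r$ avoids all the patterns $\sigma_i$-$1$ ($i\in I$).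
   Context: $\mathcal{S}_n$ is the set of permutations of $[n]=\{1,\dots,n\}$, written as words. A (partially ordered generalized) pattern is a nonempty word $p_1p_2\dots p_m$ of positive integers (repetitions allowed) with a dash written between some of the consecutive letters; it is contiguous if it has no dashes. An occurrence of it in a word $w=a_1\dots a_N$ of distinct integers (in particular in a permutation or a factor of a permutation) is a subsequence $a_{j_1}a_{j_2}\dots a_{j_m}$, $j_1<\dots<j_m$, such that (a) $p_s>p_t$ implies $a_{j_s}>a_{j_t}$ for all $s,t$ (no condition when $p_s=p_t$), and (b) $j_{s+1}=j_s+1$ whenever $p_s$ and $p_{s+1}$ are not separated by a dash. $w$ avoids the pattern if it has no occurrence of it. The notation $k$-$\sigma$-$k$ means the letter $k$, a dash, $\sigma$, a dash, and again the letter $k$; similarly for $k$-$\sigma$ and $\sigma$-$k$. -}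

module Defs where

open import Data.Bool.Base using (Bool; true; false)
open import Data.Fin.Base as Fin using (Fin; toℕ; inject₁)
open import Data.List.Base as List using (List; upTo)
open import Data.List.Relation.Binary.Permutation.Propositional using (_↭_)
open import Data.Nat.Base using (ℕ; suc; _<_; _>_; NonZero)
open import Data.Refinement using (Refinement; _,_; value)
open import Data.Irrelevant using ([_])
open import Data.Vec.Base using (Vec; _∷_; _∷ʳ_; lookup)
open import Data.Vec.Relation.Unary.All using (All)
open import Relation.Binary.PropositionalEquality.Core using (_≡_)
open import Relation.Nullary.Negation.Core using (¬_)

Letter : Set
Letter = Refinement ℕ NonZero

one : Letter
one = 1 , [ _ ]

_<ᴸ_ : Letter → Letter → Set
k <ᴸ l = value k < value l

-- The word p₁ … pₘ₊₁, where entry s of dashes is true exactly when a dash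
-- separates the letters at positions inject₁ s and suc s.
record Pattern : Set where
  constructor mkPattern
  field
    {m}     : ℕ
    letters : Vec Letter (suc m)
    dashes  : Vec Bool m

open Pattern public

AllLetters : (Letter → Set) → Pattern → Set
AllLetters P p = All P (letters p)

Contiguous : Pattern → Set
Contiguous p = All (_≡ false) (dashes p)

infixr 5 _-∷_
infixl 6 _∷ʳ-_

-- k -∷ p is k-p, and p ∷ʳ- k is p-k, so k -∷ p ∷ʳ- k is k-p-k.
_-∷_ : Letter → Pattern → Pattern
k -∷ p = mkPattern (k ∷ letters p) (true ∷ dashes p)

_∷ʳ-_ : Pattern → Letter → Pattern
p ∷ʳ- k = mkPattern (letters p ∷ʳ k) (dashes p ∷ʳ true)

record Occurrence (p : Pattern) (w : List ℕ) : Set where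
  field
    position   : Fin (suc (m p)) → Fin (List.length w)
    increasing : ∀ {s t} → s Fin.< t → position s Fin.< position t
    order      : ∀ s t → lookup (letters p) t <ᴸ lookup (letters p) s →
                 List.lookup w (position s) > List.lookup w (position t)
    adjacent   : ∀ s → lookup (dashes p) s ≡ false →
                 toℕ (position (Fin.suc s)) ≡ suc (toℕ (position (inject₁ s)))

_Avoids_ : List ℕ → Pattern → Set
w Avoids p = ¬ Occurrence p w

_AvoidsAll_ : ∀ {ℓ} {I : Set ℓ} → List ℕ → (I → Pattern) → Set ℓ
w AvoidsAll p = ∀ i → w Avoids p i

_∈𝒮_ : List ℕ → ℕ → Set
w ∈𝒮 n = w ↭ List.map suc (upTo n)

{-# OPTIONS --safe #-}
-- A contiguous occurrence of σ whose letters all differ from x cannot straddle x, so it lies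
-- on one side of x, together with the outer letter on that side.  This restricts an occurrence
-- of k-σ-k to one of k-σ in the left part or of σ-k in the right part.  Conversely, as x is
-- extremal in the word, it can play the role of the missing outer letter.
module Submission where

open import Defs
open import Data.Bool.Base using (true; false)
open import Data.Fin.Base as Fin using (Fin; zero; suc; toℕ; inject₁; fromℕ)
open import Data.Fin.Induction using (<-weakInduction)
open import Data.Fin.Properties using (toℕ-injective; toℕ-inject₁; toℕ-fromℕ; toℕ<n; ≤fromℕ)
open import Data.Fin.Relation.Unary.Top using (View; view; view-inject₁; ‵fromℕ; ‵inject₁)
open import Data.List.Base as List using (List; []; _∷_; _++_; length)
open import Data.List.Membership.Propositional using (_∈_)
open import Data.List.Membership.Propositional.Properties using (∈-lookup; ∈-map⁻; ∈-upTo⁻)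
open import Data.List.Relation.Binary.Permutation.Propositional.Properties using (∈-resp-↭)
open import Data.Nat.Base using (ℕ; suc; _+_; _≤_; _<_; z≤n; s≤s; s<s; s<s⁻¹; z<s; s≤s⁻¹)
open import Data.Nat.Properties
open import Data.Product.Base using (_×_; _,_; proj₁; proj₂)
open import Data.Sum.Base using (_⊎_; inj₁; inj₂; [_,_]; map)
open import Data.Vec.Base as Vec using (Vec; _∷_; _∷ʳ_; lookup)
open import Data.Vec.Relation.Unary.All.Properties using (lookup⁺)
open import Function.Base using (_∘_)
open import Function.Bundles using (_⇔_; mk⇔; module Equivalence)
open import Relation.Binary.Definitions using (tri<; tri≈; tri>)
open import Relation.Binary.PropositionalEquality.Core
  using (_≡_; _≢_; refl; sym; trans; cong; subst; subst₂)
open import Relation.Binary.PropositionalEquality.Properties using (module ≡-Reasoning)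
open import Relation.Nullary.Negation.Core using (¬_; contradiction)

open Occurrence

-- Removing and adding outer letters of an occurrence

lookup-∷ʳ-fromℕ : ∀ {a} {A : Set a} {n} (xs : Vec A n) x → lookup (xs ∷ʳ x) (fromℕ n) ≡ x
lookup-∷ʳ-fromℕ Vec.[]   x = refl
lookup-∷ʳ-fromℕ (_ ∷ xs) x = lookup-∷ʳ-fromℕ xs x

lookup-∷ʳ-inject₁ : ∀ {a} {A : Set a} {n} (xs : Vec A n) x i →
                    lookup (xs ∷ʳ x) (inject₁ i) ≡ lookup xs i
lookup-∷ʳ-inject₁ (_ ∷ xs) x zero    = refl
lookup-∷ʳ-inject₁ (_ ∷ xs) x (suc i) = lookup-∷ʳ-inject₁ xs x i

inject₁<fromℕ : ∀ {n} (i : Fin n) → inject₁ i Fin.< fromℕ n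
inject₁<fromℕ {n} i = subst₂ _<_ (sym (toℕ-inject₁ i)) (sym (toℕ-fromℕ n)) (toℕ<n i)

letterAt : ∀ {p w} → Occurrence p w → Fin (suc (m p)) → ℕ
letterAt {w = w} o s = List.lookup w (position o s)

-- The order condition on a single pair of positions, in both directions. Pattern letters and word
-- letters are free parameters, so that one word letter can be exchanged for another.
Consistent : Letter → ℕ → Letter → ℕ → Set
Consistent k a l b = (l <ᴸ k → b < a) × (k <ᴸ l → a < b)

consistent : ∀ {p w} (o : Occurrence p w) s t →
             Consistent (lookup (letters p) s) (letterAt o s) (lookup (letters p) t) (letterAt o t)
consistent o s t = order o s t , order o t s

Consistent-refl : ∀ {k a b} → Consistent k a k b
Consistent-refl =
  (λ k<k → contradiction k<k (<-irrefl refl)) ,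
  (λ k<k → contradiction k<k (<-irrefl refl))

-∷⁻ : ∀ {k p w} → Occurrence (k -∷ p) w → Occurrence p w
-∷⁻ o .position       = position o ∘ suc
-∷⁻ o .increasing s<t = increasing o (s<s s<t)
-∷⁻ o .order s t      = order o (suc s) (suc t)
-∷⁻ o .adjacent s     = adjacent o (suc s)

-- The dash after `k` demands no adjacency, so a new first letter only has to precede all positions
-- and compare correctly with each letter.
-∷⁺ : ∀ {k p w} (o : Occurrence p w) (j : Fin (length w)) →
      (∀ s → j Fin.< position o s) →
      (∀ s → Consistent k (List.lookup w j) (lookup (letters p) s) (letterAt o s)) →
      Occurrence (k -∷ p) w
-∷⁺ o j j< c .position zero                      = j
-∷⁺ o j j< c .position (suc s)                   = position o s
-∷⁺ o j j< c .increasing {zero}  {suc t} _       = j< t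
-∷⁺ o j j< c .increasing {suc s} {suc t} s<t     = increasing o (s<s⁻¹ s<t)
-∷⁺ o j j< c .order zero    zero    k<k          = contradiction k<k (<-irrefl refl)
-∷⁺ o j j< c .order zero    (suc t)              = proj₁ (c t)
-∷⁺ o j j< c .order (suc s) zero                 = proj₂ (c s)
-∷⁺ o j j< c .order (suc s) (suc t)              = order o s t
-∷⁺ o j j< c .adjacent (suc s)                   = adjacent o s

∷ʳ-⁻ : ∀ {k p w} → Occurrence (p ∷ʳ- k) w → Occurrence p w
∷ʳ-⁻ o .position               = position o ∘ inject₁
∷ʳ-⁻ o .increasing {s} {t} s<t =
  increasing o (subst₂ _<_ (sym (toℕ-inject₁ s)) (sym (toℕ-inject₁ t)) s<t)
∷ʳ-⁻ {k} {p} o .order s t lt   = order o (inject₁ s) (inject₁ t)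
  (subst₂ _<ᴸ_ (sym (lookup-∷ʳ-inject₁ (letters p) k t)) (sym (lookup-∷ʳ-inject₁ (letters p) k s)) lt)
∷ʳ-⁻ {k} {p} o .adjacent s eq  =
  adjacent o (inject₁ s) (trans (lookup-∷ʳ-inject₁ (dashes p) true s) eq)

-- Mirror image of `-∷⁺`. The last index is not a constructor of `Fin`, so every field goes through
-- the top view, which separates the new index `fromℕ` from the old ones `inject₁ s`.
∷ʳ-⁺ : ∀ {k p w} (o : Occurrence p w) (j : Fin (length w)) →
       (∀ s → position o s Fin.< j) →
       (∀ s → Consistent k (List.lookup w j) (lookup (letters p) s) (letterAt o s)) →
       Occurrence (p ∷ʳ- k) w
∷ʳ-⁺ {k} {p} {w} o j <j c = record
  { position   = λ s → pos (view s)
  ; increasing = λ {s} {t} → inc (view s) (view t)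
  ; order      = λ s t → ord (view s) (view t)
  ; adjacent   = λ s → adj s (view s)
  }
  where
  pos : ∀ {s : Fin (suc (suc (m p)))} → View s → Fin (length w)
  pos ‵fromℕ       = j
  pos (‵inject₁ s) = position o s

  pos-inject₁ : ∀ s → pos (view (inject₁ s)) ≡ position o s
  pos-inject₁ s = cong pos (view-inject₁ s)

  inc : ∀ {s t} (v : View s) (u : View t) → s Fin.< t → pos v Fin.< pos u
  inc {t = t} ‵fromℕ u lt = contradiction lt (≤⇒≯ (≤fromℕ t))
  inc (‵inject₁ s) ‵fromℕ lt = <j s
  inc (‵inject₁ s) (‵inject₁ t) lt =
    increasing o (subst₂ _<_ (toℕ-inject₁ s) (toℕ-inject₁ t) lt)

  ord : ∀ {s t} (v : View s) (u : View t) →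
        lookup (letters p ∷ʳ k) t <ᴸ lookup (letters p ∷ʳ k) s →
        List.lookup w (pos u) < List.lookup w (pos v)
  ord ‵fromℕ ‵fromℕ lt = contradiction lt (<-irrefl refl)
  ord ‵fromℕ (‵inject₁ t) lt
    rewrite lookup-∷ʳ-fromℕ (letters p) k | lookup-∷ʳ-inject₁ (letters p) k t = proj₁ (c t) lt
  ord (‵inject₁ s) ‵fromℕ lt
    rewrite lookup-∷ʳ-fromℕ (letters p) k | lookup-∷ʳ-inject₁ (letters p) k s = proj₂ (c s) lt
  ord (‵inject₁ s) (‵inject₁ t) lt
    rewrite lookup-∷ʳ-inject₁ (letters p) k s | lookup-∷ʳ-inject₁ (letters p) k t = order o s t lt

  adj : ∀ s → View s → lookup (dashes p ∷ʳ true) s ≡ false →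
        toℕ (pos (view (suc s))) ≡ suc (toℕ (pos (view (inject₁ s))))
  -- The top entry of `dashes p ∷ʳ true` is the new dash, so the hypothesis is absurd.
  adj s ‵fromℕ eq with () ← trans (sym (lookup-∷ʳ-fromℕ (dashes p) true)) eq
  adj _ (‵inject₁ s) eq =
    -- Since `suc (inject₁ s)` computes to `inject₁ (suc s)`, both ends are old positions.
    trans (cong toℕ (pos-inject₁ (suc s)))
      (trans (adjacent o s (trans (sym (lookup-∷ʳ-inject₁ (dashes p) true s)) eq))
        (cong (suc ∘ toℕ) (sym (pos-inject₁ (inject₁ s)))))


-- Moving occurrences between a word and its factors

-- Position i of u and position j of v carry the same letter, and j − i = d − c.
record Aligned (c d : ℕ) (u v : List ℕ) (i : Fin (length u)) : Set where
  constructor aligned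
  field
    index  : Fin (length v)
    letter : List.lookup v index ≡ List.lookup u i
    offset : c + toℕ index ≡ d + toℕ i

open Aligned

-- All positions move by the same amount, so their order and their adjacencies survive. The shift is
-- given by two summands to be cancelled, which covers moves in either direction without truncated
-- subtraction.
translate : ∀ {c d p u v} (o : Occurrence p u) → (∀ s → Aligned c d u v (position o s)) →
            Occurrence p v
translate o al .position s = index (al s)
translate {c} {d} o al .increasing {s} {t} s<t =
  +-cancelˡ-< c _ _
    (subst₂ _<_ (sym (offset (al s))) (sym (offset (al t))) (+-monoʳ-< d (increasing o s<t)))
translate o al .order s t lt =
  subst₂ _<_ (sym (letter (al t))) (sym (letter (al s))) (order o s t lt)
translate {c} {d} o al .adjacent s eq = +-cancelˡ-≡ c _ _ (begin
  c + toℕ (index (al (suc s)))          ≡⟨ offset (al (suc s)) ⟩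
  d + toℕ (position o (suc s))          ≡⟨ cong (d +_) (adjacent o s eq) ⟩
  d + suc (toℕ (position o (inject₁ s))) ≡⟨ +-suc d _ ⟩
  suc (d + toℕ (position o (inject₁ s))) ≡⟨ cong suc (offset (al (inject₁ s))) ⟨
  suc (c + toℕ (index (al (inject₁ s)))) ≡⟨ +-suc c _ ⟨
  c + suc (toℕ (index (al (inject₁ s)))) ∎)
  where open ≡-Reasoning

embedˡ : ∀ xs {ys} i → Aligned 0 0 xs (xs ++ ys) i
embedˡ (x ∷ xs) zero    = aligned zero refl refl
embedˡ (x ∷ xs) (suc i) with aligned j l o ← embedˡ xs i = aligned (suc j) l (cong suc o)

embedʳ : ∀ xs {ys} i → Aligned 0 (length xs) ys (xs ++ ys) i
embedʳ []       i = aligned i refl refl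
embedʳ (x ∷ xs) i with aligned j l o ← embedʳ xs i = aligned (suc j) l (cong suc o)

restrictˡ : ∀ xs {ys} j → toℕ j < length xs → Aligned 0 0 (xs ++ ys) xs j
restrictˡ (x ∷ xs) zero    _  = aligned zero refl refl
restrictˡ (x ∷ xs) (suc j) lt with aligned i l o ← restrictˡ xs j (s<s⁻¹ lt) =
  aligned (suc i) l (cong suc o)

restrictʳ : ∀ xs {ys} j → length xs ≤ toℕ j → Aligned (length xs) 0 (xs ++ ys) ys j
restrictʳ []       j       _  = aligned j refl refl
restrictʳ (x ∷ xs) (suc j) le with aligned i l o ← restrictʳ xs j (s≤s⁻¹ le) =
  aligned i l (cong suc o)

-- Index zero would force `toℕ i` to equal `c`; every other index loses one, and the left summand
-- makes up for it.
uncons-aligned : ∀ {c u x xs i} → c < toℕ i → Aligned c 0 u (x ∷ xs) i → Aligned (suc c) 0 u xs i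
uncons-aligned {c} c<i (aligned zero    l o) =
  contradiction (trans (sym o) (+-identityʳ c)) (>⇒≢ c<i)
uncons-aligned {c} c<i (aligned (suc j) l o) = aligned j l (trans (sym (+-suc c _)) o)

-- Splitting around an extremal letter

-- A discrete intermediate value argument: steps of size one cannot jump over `c`, so the side of
-- `f zero` is kept throughout.
one-sided : ∀ {n} (f : Fin (suc n) → ℕ) c → (∀ s → f (suc s) ≡ suc (f (inject₁ s))) →
            (∀ s → f s ≢ c) → (∀ s → f s < c) ⊎ (∀ s → c < f s)
one-sided f c step ≢c with <-cmp (f zero) c
... | tri< lt _ _ = inj₁ (<-weakInduction _ lt
  -- By definition `ih` is `suc (f (inject₁ s)) ≤ c`, that is `f (suc s) ≤ c`; missing `c` makes it
  -- strict.
  (λ s ih → ≤∧≢⇒< (subst (_≤ c) (sym (step s)) ih) (≢c (suc s))))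
... | tri≈ _ eq _ = contradiction eq (≢c zero)
... | tri> _ _ gt = inj₂ (<-weakInduction _ gt
  (λ s ih → subst (c <_) (sym (step s)) (m<n⇒m<1+n ih)))

-- Treats maximum and minimum at once: if some letter of `w` can play `k` against `b` playing `l`,
-- then so can `x`. The first component supplies a missing outer letter, the second keeps the
-- letters of `σ` off `x`.
Extremal : Letter → ℕ → List ℕ → Letter → Set
Extremal k x w l = ∀ {a b} → a ∈ w → Consistent k a l b → Consistent k x l b × b ≢ x

module _ {k : Letter} {x : ℕ} {σ : Pattern} (xs ys : List ℕ)
         (ext : ∀ s → Extremal k x (xs ++ x ∷ ys) (lookup (letters σ) s)) where

  private
    w : List ℕ
    w = xs ++ x ∷ ys

    peak : Aligned 0 (length xs) (x ∷ ys) w zero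
    peak = embedʳ xs zero

    toℕ-peak : toℕ (index peak) ≡ length xs
    toℕ-peak = trans (offset peak) (+-identityʳ _)

  lookup-peak : ∀ (j : Fin (length w)) → toℕ j ≡ length xs → List.lookup w j ≡ x
  lookup-peak j eq =
    trans (cong (List.lookup w) (toℕ-injective (trans eq (sym toℕ-peak)))) (letter peak)

  extendˡ : Occurrence (k -∷ σ) xs → Occurrence (k -∷ σ ∷ʳ- k) w
  extendˡ o = ∷ʳ-⁺ o′ (index peak) before compatible
    where
    al : ∀ s → Aligned 0 0 xs w (position o s)
    al s = embedˡ xs (position o s)

    o′ : Occurrence (k -∷ σ) w
    o′ = translate o al

    before : ∀ s → position o′ s Fin.< index peak
    before s = subst₂ _<_ (sym (offset (al s))) (sym toℕ-peak) (toℕ<n (position o s))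

    compatible : ∀ s → Consistent k (List.lookup w (index peak))
                                    (lookup (letters (k -∷ σ)) s) (letterAt o′ s)
    compatible zero    = Consistent-refl {k}
    compatible (suc s) rewrite letter peak =
      -- The letter playing the leading `k` is the witness that lets `x` play the trailing one.
      proj₁ (ext s (∈-lookup (position o′ zero)) (consistent o′ zero (suc s)))

  extendʳ : Occurrence (σ ∷ʳ- k) ys → Occurrence (k -∷ σ ∷ʳ- k) w
  extendʳ o = -∷⁺ o′ (index peak) after (λ s → compatible (view s))
    where
    al : ∀ s → Aligned 0 (suc (length xs)) ys w (position o s)
    -- The index is raised by one to skip `x` in `x ∷ ys`; `+-suc` then moves that one into the
    -- offset.
    al s with aligned j l eq ← embedʳ xs {x ∷ ys} (suc (position o s)) =
      aligned j l (trans eq (+-suc _ _))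

    o′ : Occurrence (σ ∷ʳ- k) w
    o′ = translate o al

    after : ∀ s → index peak Fin.< position o′ s
    after s = subst₂ _<_ (sym toℕ-peak) (sym (offset (al s))) (s≤s (m≤m+n _ _))

    compatible : ∀ {s} → View s →
                 Consistent k (List.lookup w (index peak))
                              (lookup (letters (σ ∷ʳ- k)) s) (letterAt o′ s)
    compatible ‵fromℕ rewrite lookup-∷ʳ-fromℕ (letters σ) k = Consistent-refl {k}
    compatible (‵inject₁ s) =
      subst₂ (λ a l → Consistent k a l (letterAt o′ (inject₁ s)))
        (sym (letter peak)) (sym (lookup-∷ʳ-inject₁ (letters σ) k s))
        (proj₁ (ext s (∈-lookup (position o′ (fromℕ _)))
          (subst₂ (λ h l → Consistent h (letterAt o′ (fromℕ _)) l (letterAt o′ (inject₁ s)))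
            (lookup-∷ʳ-fromℕ (letters σ) k) (lookup-∷ʳ-inject₁ (letters σ) k s)
            (consistent o′ (fromℕ _) (inject₁ s)))))

  -- Contiguity makes the positions of `σ` consecutive, and extremality keeps them off `x`, so
  -- `one-sided` applies. An outer `k` may itself sit on `x`, but then it is the one discarded.
  restrict : Contiguous σ → Occurrence (k -∷ σ ∷ʳ- k) w →
             Occurrence (k -∷ σ) xs ⊎ Occurrence (σ ∷ʳ- k) ys
  restrict contiguous o = map left right
    (one-sided (toℕ ∘ position block) (length xs)
      (λ s → adjacent block s (lookup⁺ contiguous s)) block-misses-peak)
    where
    init : Occurrence (k -∷ σ) w
    init = ∷ʳ-⁻ {k} {k -∷ σ} o

    tail : Occurrence (σ ∷ʳ- k) w
    tail = -∷⁻ o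

    block : Occurrence σ w
    block = -∷⁻ init

    block-misses-peak : ∀ s → toℕ (position block s) ≢ length xs
    block-misses-peak s =
      proj₂ (ext s (∈-lookup (position init zero)) (consistent init zero (suc s)))
        ∘ lookup-peak (position block s)

    left : (∀ s → toℕ (position block s) < length xs) → Occurrence (k -∷ σ) xs
    left block< = translate init (λ s → restrictˡ xs _ (init< s))
      where
      init< : ∀ s → toℕ (position init s) < length xs
      init< zero    = <-trans (increasing init z<s) (block< zero)
      init< (suc s) = block< s

    right : (∀ s → length xs < toℕ (position block s)) → Occurrence (σ ∷ʳ- k) ys
    right <block = translate tail
      (λ s → uncons-aligned (<tail (view s)) (restrictʳ xs _ (<⇒≤ (<tail (view s)))))
      where
      <tail : ∀ {s} → View s → length xs < toℕ (position tail s)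
      -- The trailing `k` comes after the first letter of the block, which is already to the right
      -- of `x`.
      <tail ‵fromℕ       = <-trans (<block zero) (increasing tail (inject₁<fromℕ zero))
      <tail (‵inject₁ s) = <block s

  avoids-⇔ : Contiguous σ →
             w Avoids (k -∷ σ ∷ʳ- k) ⇔ (xs Avoids (k -∷ σ) × ys Avoids (σ ∷ʳ- k))
  avoids-⇔ contiguous = mk⇔
    (λ avoids → avoids ∘ extendˡ , avoids ∘ extendʳ)
    (λ (avoidsˡ , avoidsʳ) → [ avoidsˡ , avoidsʳ ] ∘ restrict contiguous)

-- Families of patterns, and the extreme letters of a permutation

-- The cut depends only on `x`, so the equivalences for single patterns combine index by index.
-- Taking the factorisation as an equation lets the same `π` be cut at two different letters.
avoidsAll-⇔ : ∀ {ℓ} {I : Set ℓ} (σ : I → Pattern) → (∀ i → Contiguous (σ i)) → (k : I → Letter) →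
              ∀ {π} {x} xs ys → π ≡ xs ++ x ∷ ys →
              (∀ i s → Extremal (k i) x π (lookup (letters (σ i)) s)) →
              π AvoidsAll (λ i → k i -∷ σ i ∷ʳ- k i) ⇔
                (xs AvoidsAll (λ i → k i -∷ σ i) × ys AvoidsAll (λ i → σ i ∷ʳ- k i))
avoidsAll-⇔ σ contiguous k xs ys refl ext = mk⇔
  (λ avoids → (λ i → proj₁ (to (split i) (avoids i))) , (λ i → proj₂ (to (split i) (avoids i))))
  (λ (avoidsˡ , avoidsʳ) i → from (split i) (avoidsˡ i , avoidsʳ i))
  where
  open Equivalence
  split = λ i → avoids-⇔ xs ys (ext i) (contiguous i)

∈𝒮⇒bounds : ∀ {n π a} → π ∈𝒮 n → a ∈ π → 1 ≤ a × a ≤ n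
∈𝒮⇒bounds perm a∈π with _ , b∈ , refl ← ∈-map⁻ suc (∈-resp-↭ perm a∈π) = s≤s z≤n , ∈-upTo⁻ b∈

-- The letter `a` playing `k` lies strictly between `b` and `n` or equals `n`; either way `b < n`,
-- which gives both components.
maximum-extremal : ∀ {k n w l} → (∀ {a} → a ∈ w → a ≤ n) → l <ᴸ k → Extremal k n w l
maximum-extremal a≤n l<k a∈w (b<a , _) =
  ((λ _ → b<n) , (λ k<l → contradiction k<l (<-asym l<k))) , <⇒≢ b<n
  where b<n = <-≤-trans (b<a l<k) (a≤n a∈w)

minimum-extremal : ∀ {k n w l} → (∀ {a} → a ∈ w → n ≤ a) → k <ᴸ l → Extremal k n w l
minimum-extremal n≤a k<l a∈w (_ , a<b) =
  ((λ l<k → contradiction l<k (<-asym k<l)) , (λ _ → n<b)) , >⇒≢ n<b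
  where n<b = ≤-<-trans (n≤a a∈w) (a<b k<l)

corollary10 : ∀ {ℓ} (I : Set ℓ) (σ : I → Pattern) → (∀ i → Contiguous (σ i)) →
    (n : ℕ) → 1 ≤ n → (π : List ℕ) → π ∈𝒮 n →
    (πₗ πᵣ : List ℕ) → π ≡ πₗ ++ n ∷ πᵣ →
    (π̂ₗ π̂ᵣ : List ℕ) → π ≡ π̂ₗ ++ 1 ∷ π̂ᵣ →
    ((k : I → Letter) → (∀ i → AllLetters (_<ᴸ k i) (σ i)) →
    π AvoidsAll (λ i → k i -∷ σ i ∷ʳ- k i) ⇔
    (πₗ AvoidsAll (λ i → k i -∷ σ i) × πᵣ AvoidsAll (λ i → σ i ∷ʳ- k i)))
    ×
    ((∀ i → AllLetters (one <ᴸ_) (σ i)) →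
    π AvoidsAll (λ i → one -∷ σ i ∷ʳ- one) ⇔
    (π̂ₗ AvoidsAll (λ i → one -∷ σ i) × π̂ᵣ AvoidsAll (λ i → σ i ∷ʳ- one)))
corollary10 I σ contiguous n 1≤n π perm πₗ πᵣ π≡ π̂ₗ π̂ᵣ π≡̂ =
  (λ k σ<k → avoidsAll-⇔ σ contiguous k πₗ πᵣ π≡
    (λ i s → maximum-extremal {k = k i} {l = lookup (letters (σ i)) s}
      (proj₂ ∘ ∈𝒮⇒bounds perm) (lookup⁺ (σ<k i) s))) ,
  (λ 1<σ → avoidsAll-⇔ σ contiguous (λ _ → one) π̂ₗ π̂ᵣ π≡̂
    (λ i s → minimum-extremal {k = one} {l = lookup (letters (σ i)) s}
      (proj₁ ∘ ∈𝒮⇒bounds perm) (lookup⁺ (1<σ i) s)))
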